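{- For every set $\Gamma\cup\{\varphi\}\subseteq For(\Sigma^{C_1}_D)$, if $\Gamma\vDash_{C^D_1}\varphi$, then $\Gamma\vdash_{C^D_1}\varphi$.
   Context: **Syntax.** $For(\Sigma^{C_1}_D)$ is the set of formulas generated from a denumerable set of propositional variables by the signature $\Sigma^{C_1}_D=\{\to,\neg,\lor,\land,\mathsf{O}\}$ ($\neg,\mathsf{O}$ unary; $\to,\lor,\land$ binary). Abbreviation: $\alpha^\circ:=\neg(\alpha\land\neg\alpha)$. **The logic $C^D_1$.** Hilbert calculus whose axiom schemas are those of $CPL^+$, the positive fragment of classical propositional logic in $\to,\land,\lor$ (for instance: $\alpha\to(\beta\to\alpha)$; $(\alpha\to(\beta\to\gamma))\to((\alpha\to\beta)\to(\alpha\to\gamma))$; $\alpha\to(\beta\to(\alpha\land\beta))$; $(\alpha\land\beta)\to\alpha$; $(\alpha\land\beta)\to\beta$; $\alpha\to(\alpha\lor\beta)$; $\beta\to(\alpha\lor\beta)$; $(\alpha\to\gamma)\to((\beta\to\gamma)\to((\alpha\lor\beta)\to\gamma))$; $\alpha\lor(\alpha\to\beta)$), plus - (EM) $\alpha\lor\neg\alpha$; (cf) $\neg\neg\alpha\to\alpha$; - (bc)' $\alpha^\circ\to(\alpha\to(\neg\alpha\to\beta))$; - (ca$_\#$)' $(\alpha^\circ\land\beta^\circ)\to(\alpha\#\beta)^\circ$ for each $\#\in\{\land,\lor,\to\}$; - ($\mathsf{O}$-K) $\mathsf{O}(\alpha\to\beta)\to(\mathsf{O}\alpha\to\mathsf{O}\beta)$;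 - ($\mathsf{O}$-E) $\mathsf{O}\bot_\alpha\to\bot_\alpha$, where $\bot_\alpha:=(\alpha\land\neg\alpha)\land\alpha^\circ$; - (ca$_{\mathsf{O}}$)' $\alpha^\circ\to(\mathsf{O}\alpha)^\circ$. The rules are Modus Ponens and $\mathsf{O}$-necessitation (from $\varphi$ infer $\mathsf{O}\varphi$). $\vdash_{C^D_1}\varphi$ means that there is a finite derivation of $\varphi$ from axioms (no premises) using the rules. $\Gamma\vdash_{C^D_1}\varphi$ means: either $\vdash_{C^D_1}\varphi$, or there are $\gamma_1,\dots,\gamma_k\in\Gamma$ ($k\ge 1$ finite) with $\vdash_{C^D_1}(\gamma_1\land\dots\land\gamma_k)\to\varphi$. **Semantics.** Let $A=\{T,t,F\}$ with $T=(1,0)$, $t=(1,1)$, $F=(0,1)$; for $a\in A$ write $a=(a_1,a_2)$. Designated values: $\mathcal{D}=\{T,t\}$. Let $\sqcap,\sqcup,\supset$ be the Boolean meet, join and implication on $\{0,1\}$, and $\bigwedge$ the meet of a non-empty subset. For $a,b\in A$, $\emptyset\neq X\subseteq A$: - $a\,\tilde\land\,b=\{c\in A: c_1=a_1\sqcap b_1\}$; $a\,\tilde\lor\,b=\{c\in A: c_1=a_1\sqcup b_1\}$; $a\,\tilde\to\,b=\{c\in A: c_1=a_1\supset b_1\}$; - $\tilde\neg_1 a=\{c\in A: c_1=a_2\text{ and }c_2\le a_1\}$; - $\tilde{\mathsf{O}}(X)=\{c\in A: c_1=\bigwedge\{x_1:x\in X\}\}$. A swap Kripke model for $C^D_1$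 is a triple $\langle W,R,\{v_w\}_{w\in W}\rangle$ where $W\ne\emptyset$, $R\subseteq W^2$ is serial (every $w$ has some $w'$ with $wRw'$), and each $v_w:For(\Sigma^{C_1}_D)\to A$ satisfies, for all $\alpha,\beta$ and all $\#\in\{\land,\lor,\to\}$: - $v_w(\alpha\#\beta)\in v_w(\alpha)\,\tilde\#\,v_w(\beta)$; $v_w(\neg\alpha)\in\tilde\neg_1 v_w(\alpha)$; $v_w(\mathsf{O}\alpha)\in\tilde{\mathsf{O}}(\{v_{w'}(\alpha): wRw'\})$; - if $v_w(\alpha)=t$ then $v_w(\alpha\land\neg\alpha)=T$; - if $v_w(\alpha),v_w(\beta)\in\{T,F\}$ then $v_w(\alpha\#\beta)\in\{T,F\}$; - if $v_w(\alpha)\in\{T,F\}$ then $v_w(\mathsf{O}\alpha)\in\{T,F\}$. $\mathcal{M},w\vDash\alpha$ means $v_w(\alpha)\in\mathcal{D}$; $\mathcal{M},w\vDash\Gamma$ means $\mathcal{M},w\vDash\gamma$ for all $\gamma\in\Gamma$. $\Gamma\vDash_{C^D_1}\alpha$ means: for every swap Kripke model $\mathcal{M}$ for $C^D_1$ and every world $w$ of it, $\mathcal{M},w\vDash\Gamma$ implies $\mathcal{M},w\vDash\alpha$. -}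

module Defs where

open import Level using (0ℓ)
open import Data.Bool.Base using (Bool; true; false; not) renaming (_≤_ to _≤ᵇ_; _∧_ to _⊓_; _∨_ to _⊔_)
open import Data.List.NonEmpty.Base using (List⁺; foldr₁)
open import Data.List.NonEmpty.Relation.Unary.All using (All)
open import Data.Nat.Base using (ℕ)
open import Data.Product.Base using (_×_; Σ-syntax; ∃-syntax)
open import Data.Sum.Base using (_⊎_)
open import Relation.Binary.Core using (Rel)
open import Relation.Binary.PropositionalEquality.Core using (_≡_)
open import Relation.Unary using (Pred; _∈_; _∪_; ｛_｝)

infix  9 _°
infix  8 ¬_ 𝖮_
infixr 7 _∧_
infixr 6 _∨_
infixr 5 _⇒_
infix  3 ⊢_ _⊢_ _⊨_

-- Formulas.  The binary connectives share one constructor because several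
-- axioms and semantic conditions are stated uniformly in # ∈ {∧, ∨, →}.

data Conn : Set where
  and or imp : Conn

data Form : Set where
  var   : ℕ → Form
  ¬_ 𝖮_ : Form → Form
  bin   : Conn → Form → Form → Form

pattern _∧_ α β = bin and α β
pattern _∨_ α β = bin or  α β
pattern _⇒_ α β = bin imp α β

_° : Form → Form
α ° = ¬ (α ∧ ¬ α)

⊥[_] : Form → Form
⊥[ α ] = (α ∧ ¬ α) ∧ α °

-- The Hilbert calculus

data Axiom : Pred Form 0ℓ where
  ⇒-K   : ∀ α β → Axiom (α ⇒ (β ⇒ α))
  ⇒-S   : ∀ α β γ → Axiom ((α ⇒ (β ⇒ γ)) ⇒ ((α ⇒ β) ⇒ (α ⇒ γ)))
  ∧-I   : ∀ α β → Axiom (α ⇒ (β ⇒ (α ∧ β)))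
  ∧-E₁  : ∀ α β → Axiom ((α ∧ β) ⇒ α)
  ∧-E₂  : ∀ α β → Axiom ((α ∧ β) ⇒ β)
  ∨-I₁  : ∀ α β → Axiom (α ⇒ (α ∨ β))
  ∨-I₂  : ∀ α β → Axiom (β ⇒ (α ∨ β))
  ∨-E   : ∀ α β γ → Axiom ((α ⇒ γ) ⇒ ((β ⇒ γ) ⇒ ((α ∨ β) ⇒ γ)))
  ∨-⇒   : ∀ α β → Axiom (α ∨ (α ⇒ β))
  EM    : ∀ α → Axiom (α ∨ ¬ α)
  cf    : ∀ α → Axiom (¬ ¬ α ⇒ α)
  bc    : ∀ α β → Axiom (α ° ⇒ (α ⇒ (¬ α ⇒ β)))
  ca    : ∀ # α β → Axiom ((α ° ∧ β °) ⇒ (bin # α β) °)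
  𝖮-K   : ∀ α β → Axiom (𝖮 (α ⇒ β) ⇒ (𝖮 α ⇒ 𝖮 β))
  𝖮-E   : ∀ α → Axiom (𝖮 ⊥[ α ] ⇒ ⊥[ α ])
  ca-𝖮  : ∀ α → Axiom (α ° ⇒ (𝖮 α) °)

data ⊢_ : Pred Form 0ℓ where
  axiom : ∀ {φ} → Axiom φ → ⊢ φ
  mp    : ∀ {φ ψ} → ⊢ φ ⇒ ψ → ⊢ φ → ⊢ ψ
  nec   : ∀ {φ} → ⊢ φ → ⊢ 𝖮 φ

⋀ : List⁺ Form → Form
⋀ = foldr₁ _∧_

-- Necessitation applies to theorems only: premises enter through an
-- implication whose antecedent is a finite conjunction of members of Γ.

_⊢_ : Pred Form 0ℓ → Form → Set
Γ ⊢ φ = (⊢ φ) ⊎ (Σ[ γs ∈ List⁺ Form ] All Γ γs × (⊢ ⋀ γs ⇒ φ))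

-- Truth values: T = (1,0), t = (1,1), F = (0,1)

data 𝔸 : Set where
  T t F : 𝔸

_₁ _₂ : 𝔸 → Bool
T ₁ = true
t ₁ = true
F ₁ = false
T ₂ = false
t ₂ = true
F ₂ = true

𝒟 : Pred 𝔸 0ℓ
𝒟 = ｛ T ｝ ∪ ｛ t ｝

Classical : Pred 𝔸 0ℓ
Classical = ｛ T ｝ ∪ ｛ F ｝

_⊃_ : Bool → Bool → Bool
x ⊃ y = not x ⊔ y

boolean : Conn → Bool → Bool → Bool
boolean and = _⊓_
boolean or  = _⊔_
boolean imp = _⊃_

bin~ : Conn → 𝔸 → 𝔸 → Pred 𝔸 0ℓ
bin~ # a b c = c ₁ ≡ boolean # (a ₁) (b ₁)

¬~ : 𝔸 → Pred 𝔸 0ℓ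
¬~ a c = (c ₁ ≡ a ₂) × (c ₂ ≤ᵇ a ₁)

-- The meet of a set of Booleans is its greatest lower bound in false ≤ true;
-- it is given as a relation since membership in the set need not be decidable.

IsMeet : Pred Bool 0ℓ → Bool → Set
IsMeet X m = (∀ x → x ∈ X → m ≤ᵇ x) × (∀ b → (∀ x → x ∈ X → b ≤ᵇ x) → b ≤ᵇ m)

-- Only used for non-empty X, by seriality of the accessibility relation.

𝖮~ : Pred 𝔸 0ℓ → Pred 𝔸 0ℓ
𝖮~ X c = IsMeet (λ b → ∃[ a ] (a ∈ X × b ≡ a ₁)) (c ₁)

record SwapKripkeModel : Set₁ where
  field
    W         : Set
    inhabited : W
    R         : Rel W 0ℓ
    serial    : ∀ w → ∃[ w′ ] R w w′
    v         : W → Form → 𝔸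
    v-bin     : ∀ w # α β → v w (bin # α β) ∈ bin~ # (v w α) (v w β)
    v-¬       : ∀ w α → v w (¬ α) ∈ ¬~ (v w α)
    v-𝖮       : ∀ w α → v w (𝖮 α) ∈ 𝖮~ (λ a → ∃[ w′ ] (R w w′ × a ≡ v w′ α))
    v-t       : ∀ w α → v w α ≡ t → v w (α ∧ ¬ α) ≡ T
    v-bin-cl  : ∀ w # α β → v w α ∈ Classical → v w β ∈ Classical →
                v w (bin # α β) ∈ Classical
    v-𝖮-cl    : ∀ w α → v w α ∈ Classical → v w (𝖮 α) ∈ Classical

_,_⊩_ : (M : SwapKripkeModel) → SwapKripkeModel.W M → Form → Set
M , w ⊩ α = SwapKripkeModel.v M w α ∈ 𝒟

_⊨_ : Pred Form 0ℓ → Form → Set₁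
Γ ⊨ φ = ∀ (M : SwapKripkeModel) (w : SwapKripkeModel.W M) →
        (∀ γ → γ ∈ Γ → M , w ⊩ γ) → M , w ⊩ φ

{-# OPTIONS --safe #-}

-- Canonical model.  The worlds are the prime, deductively closed, proper sets
-- of formulas, and a world w gives α the value whose coordinates record whether
-- α ∈ w and whether ¬ α ∈ w; F stands for all cases with α ∉ w, since EM then
-- forces ¬ α ∈ w.  If a world contains at most one of α and ¬ α, it omits
-- α ∧ ¬ α, so it contains α ° by EM; this turns the schemas ca and ca-𝖮 into the
-- conditions on classical values.  Accessibility is serial because 𝖮-E and bc
-- make 𝖮 ⊥[ α ] explosive.

module Submission where

open import Level using (0ℓ)
open import Axiom.ExcludedMiddle using (ExcludedMiddle)
open import Data.Bool.Base using (Bool; true; false; f≤t; b≤b)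
  renaming (T to True; _∨_ to _⊔_; _≤_ to _≤ᵇ_)
open import Data.Bool.Properties using (T-≡; T-∧; T-∨; ⇔→≡)
open import Data.Empty using (⊥; ⊥-elim)
open import Data.List.Base using (List; []; _∷_; _++_; map; cartesianProduct; cartesianProductWith)
open import Data.List.Membership.Propositional using () renaming (_∈_ to _∈ˡ_)
open import Data.List.Membership.Propositional.Properties
  using (∈-map⁺; ∈-++⁺ˡ; ∈-++⁺ʳ; ∈-cartesianProduct⁺; ∈-cartesianProductWith⁺)
open import Data.List.NonEmpty.Base using (List⁺; _∷_; _⁺++⁺_)
open import Data.List.NonEmpty.Relation.Unary.All using (_∷_)
open import Data.List.Relation.Unary.All using ([]; _∷_)
import Data.List.Relation.Unary.All.Properties as Allₚ
open import Data.List.Relation.Unary.Any using (here; there)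
open import Data.Nat.Base using (ℕ; zero; suc; _≤′_; ≤′-refl; ≤′-step) renaming (_⊔_ to _⊔ⁿ_)
open import Data.Nat.Properties using (≤⇒≤′; m≤m⊔n; m≤n⊔m)
open import Data.Product.Base using (_×_; _,_; ∃-syntax; proj₁; proj₂; uncurry)
open import Data.Sum.Base as Sum using (_⊎_; inj₁; inj₂; [_,_]′)
open import Data.Unit.Base using (tt)
open import Function.Base using (id; _∘_)
open import Function.Bundles using (_⇔_; mk⇔; Equivalence)
open import Function.Properties.Equivalence using () renaming (sym to ⇔-sym; trans to ⇔-trans)
open import Relation.Binary.PropositionalEquality.Core using (_≡_; refl; sym; subst)
open import Relation.Nullary.Decidable.Core using (yes; no; isYes; fromWitness; toWitness)
open import Relation.Unary using (Pred; _∈_; _∉_; _⊆_; _∪_; ｛_｝)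

open import Defs

open Equivalence using (to; from)

-- Derivations from premises and the deduction theorem.

infix 3 _▷_

-- Building detachment in as a constructor allows induction on derivations. Necessitation stays
-- confined to `theorem`, which is what lets the deduction theorem hold.
data _▷_ (Γ : Pred Form 0ℓ) : Pred Form 0ℓ where
  theorem : ∀ {φ} → ⊢ φ → Γ ▷ φ
  premise : ∀ {φ} → φ ∈ Γ → Γ ▷ φ
  detach  : ∀ {φ ψ} → Γ ▷ φ ⇒ ψ → Γ ▷ φ → Γ ▷ ψ

private variable
  Γ Δ     : Pred Form 0ℓ
  α β γ φ : Form

⇒-refl : ∀ α → ⊢ α ⇒ α
⇒-refl α = mp (mp (axiom (⇒-S α (α ⇒ α) α)) (axiom (⇒-K α (α ⇒ α)))) (axiom (⇒-K α α))

⇒-const : ∀ α → ⊢ β → ⊢ α ⇒ β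
⇒-const α p = mp (axiom (⇒-K _ α)) p

⇒-app : ⊢ α ⇒ (β ⇒ γ) → ⊢ α ⇒ β → ⊢ α ⇒ γ
⇒-app p q = mp (mp (axiom (⇒-S _ _ _)) p) q

⇒-trans : ⊢ α ⇒ β → ⊢ β ⇒ γ → ⊢ α ⇒ γ
⇒-trans p q = ⇒-app (⇒-const _ q) p

▷-bind : (∀ {γ} → γ ∈ Γ → Δ ▷ γ) → Γ ▷ φ → Δ ▷ φ
▷-bind h (theorem p)  = theorem p
▷-bind h (premise p)  = h p
▷-bind h (detach p q) = detach (▷-bind h p) (▷-bind h q)

▷-mono : Γ ⊆ Δ → Γ ▷ φ → Δ ▷ φ
▷-mono Γ⊆Δ = ▷-bind (premise ∘ Γ⊆Δ)

deduction : Γ ∪ ｛ α ｝ ▷ φ → Γ ▷ α ⇒ φ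
deduction (theorem p)            = theorem (⇒-const _ p)
deduction (premise (inj₁ p))     = detach (theorem (axiom (⇒-K _ _))) (premise p)
deduction (premise (inj₂ refl))  = theorem (⇒-refl _)
deduction (detach p q)           =
  detach (detach (theorem (axiom (⇒-S _ _ _))) (deduction p)) (deduction q)

cut : Γ ▷ α → Γ ∪ ｛ α ｝ ▷ φ → Γ ▷ φ
cut p q = detach (deduction q) p

-- From derivations to implications from finite conjunctions.

-- `⋀` nests to the right and has no unit, so the recursion on the first list bottoms out at a
-- singleton.
⋀-++ˡ : ∀ x xs (ys : List⁺ Form) → ⊢ ⋀ ((x ∷ xs) ⁺++⁺ ys) ⇒ ⋀ (x ∷ xs)
⋀-++ˡ x []        (y ∷ ys) = axiom (∧-E₁ _ _)
⋀-++ˡ x (x′ ∷ xs) ys       =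
  ⇒-app (⇒-trans (axiom (∧-E₁ _ _)) (axiom (∧-I _ _)))
        (⇒-trans (axiom (∧-E₂ _ _)) (⋀-++ˡ x′ xs ys))

⋀-++ʳ : ∀ x xs (ys : List⁺ Form) → ⊢ ⋀ ((x ∷ xs) ⁺++⁺ ys) ⇒ ⋀ ys
⋀-++ʳ x []        (y ∷ ys) = axiom (∧-E₂ _ _)
⋀-++ʳ x (x′ ∷ xs) ys       = ⇒-trans (axiom (∧-E₂ _ _)) (⋀-++ʳ x′ xs ys)

-- Two premise lists are pooled by concatenation; a theorem contributes no list, so the mixed cases
-- keep the other one.
⊢-detach : Γ ⊢ α ⇒ β → Γ ⊢ α → Γ ⊢ β
⊢-detach (inj₁ p)            (inj₁ q)            = inj₁ (mp p q)
⊢-detach (inj₁ p)            (inj₂ (ys , b , q)) = inj₂ (ys , b , ⇒-trans q p)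
⊢-detach (inj₂ (xs , a , p)) (inj₁ q)            = inj₂ (xs , a , ⇒-app p (⇒-const _ q))
⊢-detach (inj₂ (x ∷ xs , a ∷ as , p)) (inj₂ (y ∷ ys , b ∷ bs , q)) =
  inj₂ ( (x ∷ xs) ⁺++⁺ (y ∷ ys) , a ∷ Allₚ.++⁺ as (b ∷ bs)
       , ⇒-app (⇒-trans (⋀-++ˡ x xs (y ∷ ys)) p) (⇒-trans (⋀-++ʳ x xs (y ∷ ys)) q))

▷⇒⊢ : Γ ▷ φ → Γ ⊢ φ
▷⇒⊢ (theorem p)  = inj₁ p
▷⇒⊢ (premise p)  = inj₂ (_ ∷ [] , p ∷ [] , ⇒-refl _)
▷⇒⊢ (detach p q) = ⊢-detach (▷⇒⊢ p) (▷⇒⊢ q)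

-- Chains of sets, compactness and an enumeration of the formulas.

module _ {A : Set} (P : ℕ → Pred A 0ℓ) (P-step : ∀ n → P n ⊆ P (suc n)) where

  chain-mono : ∀ {m n} → m ≤′ n → P m ⊆ P n
  chain-mono ≤′-refl       p = p
  chain-mono (≤′-step m≤n) p = P-step _ (chain-mono m≤n p)

  chain-⊔ˡ : ∀ m n → P m ⊆ P (m ⊔ⁿ n)
  chain-⊔ˡ m n = chain-mono (≤⇒≤′ (m≤m⊔n m n))

  chain-⊔ʳ : ∀ m n → P n ⊆ P (m ⊔ⁿ n)
  chain-⊔ʳ m n = chain-mono (≤⇒≤′ (m≤n⊔m m n))

-- A derivation uses finitely many premises, and a growing chain has a stage containing them all; at
-- `detach` the larger of two stages serves.
▷-compact : (P : ℕ → Pred Form 0ℓ) → (∀ n → P n ⊆ P (suc n)) →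
            (λ α → ∃[ n ] α ∈ P n) ▷ φ → ∃[ n ] (P n ▷ φ)
▷-compact P step (theorem p)       = zero , theorem p
▷-compact P step (premise (n , p)) = n , premise p
▷-compact P step (detach p q)      =
  let m , p′ = ▷-compact P step p
      n , q′ = ▷-compact P step q
  in m ⊔ⁿ n , detach (▷-mono (chain-⊔ˡ P step m n) p′) (▷-mono (chain-⊔ʳ P step m n) q′)

conns : List Conn
conns = and ∷ or ∷ imp ∷ []

∈-conns : ∀ # → # ∈ˡ conns
∈-conns and = here refl
∈-conns or  = there (here refl)
∈-conns imp = there (there (here refl))

-- Each list contains the previous one, so both arguments of a binary formula can be found in one
-- list. Repetitions are harmless.
forms : ℕ → List Form
forms zero    = []
forms (suc n) = var n ∷ forms n ++ map ¬_ (forms n) ++ map 𝖮_ (forms n) ++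
  cartesianProductWith (λ # → uncurry (bin #)) conns (cartesianProduct (forms n) (forms n))

forms-step : ∀ n {α} → α ∈ˡ forms n → α ∈ˡ forms (suc n)
forms-step n = there ∘ ∈-++⁺ˡ

forms-complete : ∀ α → ∃[ n ] α ∈ˡ forms n
forms-complete (var i) = suc i , here refl
forms-complete (¬ α)   =
  let n , p = forms-complete α
  in suc n , there (∈-++⁺ʳ (forms n) (∈-++⁺ˡ (∈-map⁺ ¬_ p)))
forms-complete (𝖮 α)   =
  let n , p = forms-complete α
  in suc n , there (∈-++⁺ʳ (forms n) (∈-++⁺ʳ (map ¬_ (forms n)) (∈-++⁺ˡ (∈-map⁺ 𝖮_ p))))
forms-complete (bin # α β) =
  let m , p = forms-complete α
      n , q = forms-complete β
      k     = m ⊔ⁿ n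
      P     = λ n α → α ∈ˡ forms n
  in suc k , there (∈-++⁺ʳ (forms k) (∈-++⁺ʳ (map ¬_ (forms k)) (∈-++⁺ʳ (map 𝖮_ (forms k))
       (∈-cartesianProductWith⁺ (λ # → uncurry (bin #)) (∈-conns #)
         (∈-cartesianProduct⁺ (chain-⊔ˡ P forms-step m n p) (chain-⊔ʳ P forms-step m n q))))))

-- Prime theories as worlds.

-- Boolean-valued membership keeps the worlds in Set, where Pred Form 0ℓ is not.

record World : Set where
  field
    mem : Form → Bool

  Mem : Pred Form 0ℓ
  Mem α = True (mem α)

  field
    closed : Mem ▷ α → α ∈ Mem
    prime  : (α ∨ β) ∈ Mem → α ∈ Mem ⊎ β ∈ Mem
    proper : ∃[ φ ] φ ∉ Mem

  ax : Axiom α → α ∈ Mem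
  ax a = closed (theorem (axiom a))

  ⇒-elim : (α ⇒ β) ∈ Mem → α ∈ Mem → β ∈ Mem
  ⇒-elim p q = closed (detach (premise p) (premise q))

  ∧-Mem : (α ∧ β) ∈ Mem ⇔ (α ∈ Mem × β ∈ Mem)
  ∧-Mem = mk⇔ (λ p → ⇒-elim (ax (∧-E₁ _ _)) p , ⇒-elim (ax (∧-E₂ _ _)) p)
              (λ (p , q) → ⇒-elim (⇒-elim (ax (∧-I _ _)) p) q)

  ∨-Mem : (α ∨ β) ∈ Mem ⇔ (α ∈ Mem ⊎ β ∈ Mem)
  ∨-Mem = mk⇔ prime [ ⇒-elim (ax (∨-I₁ _ _)) , ⇒-elim (ax (∨-I₂ _ _)) ]′

  -- The converse direction is classical: by primeness `∨-⇒` puts either `α` or the implication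
  -- itself in the world, and in the first case `h` and `⇒-K` finish.
  ⇒-Mem : (α ⇒ β) ∈ Mem ⇔ (α ∈ Mem → β ∈ Mem)
  ⇒-Mem {α} {β} = mk⇔ ⇒-elim λ h →
    [ (λ p → ⇒-elim (ax (⇒-K _ _)) (h p)) , id ]′ (prime (ax (∨-⇒ α β)))

  Consistent : Pred Form 0ℓ
  Consistent α = α ∈ Mem → (¬ α) ∈ Mem → ⊥

  °-consistent : (α °) ∈ Mem → α ∈ Consistent
  °-consistent c p q = proj₂ proper (⇒-elim (⇒-elim (⇒-elim (ax (bc _ _)) c) p) q)

  consistent-° : α ∈ Consistent → (α °) ∈ Mem
  consistent-° {α} h =
    [ (λ p → ⊥-elim (uncurry h (to ∧-Mem p))) , id ]′ (prime (ax (EM (α ∧ ¬ α))))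

  -- The conjuncts of `⊥[ α ]` are exactly the antecedents of `bc`, so containing it would
  -- contradict `proper`.
  ⊥-∉ : ∀ α → ⊥[ α ] ∉ Mem
  ⊥-∉ α p = let q , c = to ∧-Mem p in uncurry (°-consistent c) (to ∧-Mem q)

open World

-- Truth values and the valuation at a world.

True-⇔→≡ : ∀ {x y} → True x ⇔ True y → x ≡ y
True-⇔→≡ h = ⇔→≡ (⇔-trans (⇔-sym T-≡) (⇔-trans h T-≡))

True-→-≤ : ∀ {x y} → (True x → True y) → x ≤ᵇ y
True-→-≤ {false} {false} h = b≤b
True-→-≤ {false} {true}  h = f≤t
True-→-≤ {true}  {true}  h = b≤b
True-→-≤ {true}  {false} h = ⊥-elim (h tt)

≤-True : ∀ {x y} → x ≤ᵇ y → True x → True y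
≤-True b≤b p = p
≤-True f≤t _ = tt

True-⊃ : ∀ {x y} → True (x ⊃ y) ⇔ (True x → True y)
True-⊃ {true}  = mk⇔ (λ p _ → p) (λ h → h tt)
True-⊃ {false} = mk⇔ (λ _ ()) (λ _ → tt)

-- The argument pair (false , false), which no world produces, is also sent to F.

value : Bool → Bool → 𝔸
value true  false = T
value true  true  = t
value false _     = F

value-₁ : ∀ x y → value x y ₁ ≡ x
value-₁ true  false = refl
value-₁ true  true  = refl
value-₁ false _     = refl

value-₂ : ∀ x y → True (x ⊔ y) → value x y ₂ ≡ y
value-₂ true  false _ = refl
value-₂ true  true  _ = refl
value-₂ false true  _ = refl

value-T : ∀ {x y} → True x → (True y → ⊥) → value x y ≡ T
value-T {true} {false} _ _ = refl
value-T {true} {true}  _ h = ⊥-elim (h tt)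

value-t : ∀ x y → value x y ≡ t → True x × True y
value-t true true _ = tt , tt

value-classical : ∀ {x y} → value x y ∈ Classical ⇔ (True x → True y → ⊥)
value-classical {true}  {false} = mk⇔ (λ _ _ ()) (λ _ → inj₁ refl)
value-classical {true}  {true}  = mk⇔ (λ { (inj₁ ()) ; (inj₂ ()) }) (λ h → ⊥-elim (h tt tt))
value-classical {false}         = mk⇔ (λ _ ()) (λ _ → inj₂ refl)

value-𝒟 : ∀ {x y} → value x y ∈ 𝒟 ⇔ True x
value-𝒟 {true}  {false} = mk⇔ (λ _ → tt) (λ _ → inj₁ refl)
value-𝒟 {true}  {true}  = mk⇔ (λ _ → tt) (λ _ → inj₂ refl)
value-𝒟 {false}         = mk⇔ (λ { (inj₁ ()) ; (inj₂ ()) }) (λ ())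

val : World → Form → 𝔸
val w α = value (mem w α) (mem w (¬ α))

val-₁ : ∀ w α → val w α ₁ ≡ mem w α
val-₁ w α = value-₁ (mem w α) (mem w (¬ α))

val-₂ : ∀ w α → val w α ₂ ≡ mem w (¬ α)
val-₂ w α = value-₂ (mem w α) (mem w (¬ α)) (from T-∨ (prime w (ax w (EM α))))

mem-bin : ∀ w # α β → mem w (bin # α β) ≡ boolean # (mem w α) (mem w β)
mem-bin w and α β = True-⇔→≡ (⇔-trans (∧-Mem w) (⇔-sym T-∧))
mem-bin w or  α β = True-⇔→≡ (⇔-trans (∨-Mem w) (⇔-sym T-∨))
mem-bin w imp α β = True-⇔→≡ (⇔-trans (⇒-Mem w) (⇔-sym True-⊃))

val-bin : ∀ w # α β → val w (bin # α β) ∈ bin~ # (val w α) (val w β)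
val-bin w # α β rewrite val-₁ w (bin # α β) | val-₁ w α | val-₁ w β = mem-bin w # α β

val-¬ : ∀ w α → val w (¬ α) ∈ ¬~ (val w α)
val-¬ w α rewrite val-₁ w (¬ α) | val-₂ w α | val-₂ w (¬ α) | val-₁ w α =
  -- The rewriting turns the inequality into `mem w (¬ ¬ α) ≤ᵇ mem w α`, which is `cf`.
  refl , True-→-≤ (⇒-elim w (ax w (cf α)))

-- The negation of `α ∧ ¬ α` is literally `α °`, which cannot lie in a world containing both `α` and
-- `¬ α`.
val-t : ∀ w α → val w α ≡ t → val w (α ∧ ¬ α) ≡ T
val-t w α e = value-T (from (∧-Mem w) (p , q)) λ c → °-consistent w c p q
  where
  pq = value-t (mem w α) (mem w (¬ α)) e
  p  = proj₁ pq
  q  = proj₂ pq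

val-classical : ∀ w α → val w α ∈ Classical ⇔ (α °) ∈ Mem w
val-classical w α = ⇔-trans value-classical (mk⇔ (consistent-° w) (°-consistent w))

val-bin-cl : ∀ w # α β → val w α ∈ Classical → val w β ∈ Classical →
             val w (bin # α β) ∈ Classical
val-bin-cl w # α β p q = from (val-classical w (bin # α β))
  (⇒-elim w (ax w (ca # α β))
    (from (∧-Mem w) (to (val-classical w α) p , to (val-classical w β) q)))

val-𝖮-cl : ∀ w α → val w α ∈ Classical → val w (𝖮 α) ∈ Classical
val-𝖮-cl w α p = from (val-classical w (𝖮 α))
  (⇒-elim w (ax w (ca-𝖮 α)) (to (val-classical w α) p))

-- The obligations of a world.

𝖮⁻¹ : World → Pred Form 0ℓ
𝖮⁻¹ w α = 𝖮 α ∈ Mem w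

-- A derivation is prefixed with `𝖮` step by step: `nec` treats theorems and `𝖮-K` treats
-- detachment.
𝖮⁻¹-closed : ∀ w → 𝖮⁻¹ w ▷ α → 𝖮 α ∈ Mem w
𝖮⁻¹-closed w (theorem p)  = closed w (theorem (nec p))
𝖮⁻¹-closed w (premise p)  = p
𝖮⁻¹-closed w (detach p q) =
  ⇒-elim w (⇒-elim w (ax w (𝖮-K _ _)) (𝖮⁻¹-closed w p)) (𝖮⁻¹-closed w q)

-- Lindenbaum's lemma.

module _ (em : ExcludedMiddle 0ℓ) where

  module Lindenbaum (φ : Form) where

    -- Guarding the new element by underivability of `φ` avoids a case distinction in the
    -- definition; excluded middle settles the guard only in proofs.
    step : Form → Pred Form 0ℓ → Pred Form 0ℓ
    step α Γ γ = γ ∈ Γ ⊎ (α ≡ γ × (Γ ∪ ｛ α ｝ ▷ φ → ⊥))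

    -- If adding `α` yields `φ`, the guard fails and nothing was added; otherwise the assumed
    -- derivation, weakened to `Γ ∪ ｛ α ｝`, is contradictory.
    step-▷ : ∀ α → step α Γ ▷ φ → Γ ▷ φ
    step-▷ {Γ} α p with em {Γ ∪ ｛ α ｝ ▷ φ}
    ... | yes q = ▷-mono (λ { (inj₁ a) → a ; (inj₂ (_ , h)) → ⊥-elim (h q) }) p
    ... | no ¬q = ⊥-elim (¬q (▷-mono (λ { (inj₁ a) → inj₁ a ; (inj₂ (a , _)) → inj₂ a }) p))

    extend : List Form → Pred Form 0ℓ → Pred Form 0ℓ
    extend []       Γ = Γ
    extend (α ∷ αs) Γ = extend αs (step α Γ)

    extend-⊇ : ∀ αs → Γ ⊆ extend αs Γ
    extend-⊇ []       p = p
    extend-⊇ (α ∷ αs) p = extend-⊇ αs (inj₁ p)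

    extend-▷ : ∀ αs → extend αs Γ ▷ φ → Γ ▷ φ
    extend-▷ []       p = p
    extend-▷ (α ∷ αs) p = step-▷ α (extend-▷ αs p)

    -- A formula rejected at its turn already yielded `φ` with the set of that moment, and this
    -- persists in every larger set.
    extend-decides : ∀ αs → α ∈ˡ αs → α ∈ extend αs Γ ⊎ (extend αs Γ ∪ ｛ α ｝ ▷ φ)
    extend-decides {Γ = Γ} (α ∷ αs) (here refl) with em {Γ ∪ ｛ α ｝ ▷ φ}
    ... | yes q = inj₂ (▷-mono (Sum.map₁ (extend-⊇ αs ∘ inj₁)) q)
    ... | no ¬q = inj₁ (extend-⊇ αs (inj₂ (refl , ¬q)))
    extend-decides (α ∷ αs) (there i) = extend-decides αs i

    module _ (Γ : Pred Form 0ℓ) (Γ⋫φ : Γ ▷ φ → ⊥) where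

      stage : ℕ → Pred Form 0ℓ
      stage zero    = Γ
      stage (suc n) = extend (forms n) (stage n)

      stage-step : ∀ n → stage n ⊆ stage (suc n)
      stage-step n = extend-⊇ (forms n)

      stage-⋫ : ∀ n → stage n ▷ φ → ⊥
      stage-⋫ zero    = Γ⋫φ
      stage-⋫ (suc n) = stage-⋫ n ∘ extend-▷ (forms n)

      limit : Pred Form 0ℓ
      limit α = ∃[ n ] α ∈ stage n

      limit-⋫ : limit ▷ φ → ⊥
      limit-⋫ p = uncurry stage-⋫ (▷-compact stage stage-step p)

      -- Maximality is measured by derivability of `φ`, not by consistency, since a formula and its
      -- negation need not explode together.
      limit-maximal : α ∉ limit → limit ∪ ｛ α ｝ ▷ φ
      limit-maximal {α} α∉ =
        let n , i = forms-complete α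
        -- `forms n` is processed in passing from `stage n` to `stage (suc n)`, hence the index
        -- `suc n`.
        in [ (λ p → ⊥-elim (α∉ (suc n , p))) , ▷-mono (Sum.map₁ (suc n ,_)) ]′
             (extend-decides (forms n) i)

      limit-closed : limit ▷ α → α ∈ limit
      limit-closed {α} p with em {α ∈ limit}
      ... | yes q = q
      ... | no ¬q = ⊥-elim (limit-⋫ (cut p (limit-maximal ¬q)))

      limit-prime : (α ∨ β) ∈ limit → α ∈ limit ⊎ β ∈ limit
      limit-prime {α} {β} p with em {α ∈ limit} | em {β ∈ limit}
      ... | yes q | _     = inj₁ q
      ... | no _  | yes q = inj₂ q
      -- Both rejected disjuncts yield `φ`, so `∨-E` would derive `φ` from the limit.
      ... | no ¬a | no ¬b = ⊥-elim (limit-⋫ (detach (detach (detach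
              (theorem (axiom (∨-E α β φ)))
              (deduction (limit-maximal ¬a))) (deduction (limit-maximal ¬b))) (premise p)))

      limit-mem : Form → Bool
      limit-mem α = isYes (em {α ∈ limit})

      mem⇒limit : ∀ α → True (limit-mem α) → α ∈ limit
      mem⇒limit α = toWitness {a? = em}

      limit⇒mem : ∀ α → α ∈ limit → True (limit-mem α)
      limit⇒mem α = fromWitness {a? = em}

      world : World
      world = record
        { mem    = limit-mem
        ; closed = λ p → limit⇒mem _ (limit-closed (▷-mono (mem⇒limit _) p))
        ; prime  = λ p → Sum.map (limit⇒mem _) (limit⇒mem _)
                           (limit-prime (mem⇒limit _ p))
        ; proper = φ , λ p → limit-⋫ (premise (mem⇒limit φ p))
        }

  lindenbaum : (Γ ▷ φ → ⊥) → ∃[ w ] (Γ ⊆ Mem w × φ ∉ Mem w)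
  lindenbaum {Γ} {φ} h =
    world Γ h , (λ p → limit⇒mem Γ h _ (zero , p)) , proj₂ (proper (world Γ h))
    where open Lindenbaum φ

  -- Accessibility and the canonical model.

  _⟶_ : World → World → Set
  w ⟶ w′ = 𝖮⁻¹ w ⊆ Mem w′

  ⟶-serial : ∀ w → ∃[ w′ ] w ⟶ w′
  ⟶-serial w =
    -- The variable `var 0` is an arbitrary choice; avoiding `⊥[ var 0 ]` only serves to make the
    -- extension possible.
    let w′ , w⟶w′ , _ = lindenbaum {φ = ⊥[ var 0 ]} λ p →
          ⊥-∉ w (var 0) (⇒-elim w (ax w (𝖮-E (var 0))) (𝖮⁻¹-closed w p))
    in w′ , w⟶w′

  -- If `𝖮⁻¹ w` does not derive `α`, Lindenbaum's lemma extends it to an accessible world omitting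
  -- `α`.
  𝖮-Mem : ∀ w → (∀ w′ → w ⟶ w′ → α ∈ Mem w′) → 𝖮 α ∈ Mem w
  𝖮-Mem {α} w h with em {𝖮⁻¹ w ▷ α}
  ... | yes p = 𝖮⁻¹-closed w p
  ... | no ¬p = let w′ , w⟶w′ , α∉ = lindenbaum ¬p in ⊥-elim (α∉ (h w′ w⟶w′))

  val-𝖮 : ∀ w α → val w (𝖮 α) ∈ 𝖮~ (λ a → ∃[ w′ ] (w ⟶ w′ × a ≡ val w′ α))
  val-𝖮 w α rewrite val-₁ w (𝖮 α) =
    -- The lower bound property is the definition of `⟶`, with the order on Booleans read as
    -- implication.
    (λ { _ (_ , (w′ , w⟶w′ , refl) , refl) →
         subst (mem w (𝖮 α) ≤ᵇ_) (sym (val-₁ w′ α)) (True-→-≤ w⟶w′) })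
    -- A true lower bound puts `α` in every accessible world, so `𝖮-Mem` applies.
    , λ b lower → True-→-≤ λ p → 𝖮-Mem w λ w′ w⟶w′ →
        subst True (val-₁ w′ α) (≤-True (lower _ (_ , (w′ , w⟶w′ , refl) , refl)) p)

  canonical : World → SwapKripkeModel
  canonical w = record
    { W = World ; inhabited = w ; R = _⟶_ ; serial = ⟶-serial ; v = val
    ; v-bin = val-bin ; v-¬ = val-¬ ; v-𝖮 = val-𝖮
    ; v-t = val-t ; v-bin-cl = val-bin-cl ; v-𝖮-cl = val-𝖮-cl
    }

proposition6p5 : ExcludedMiddle 0ℓ → (Γ : Pred Form 0ℓ) (φ : Form) → Γ ⊨ φ → Γ ⊢ φ
proposition6p5 em Γ φ Γ⊨φ with em {Γ ▷ φ}
... | yes p = ▷⇒⊢ p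
... | no ¬p =
  -- By `value-𝒟`, satisfaction at a canonical world is membership in it, so `w` would refute the
  -- assumed consequence.
  let w , Γ⊆w , φ∉w = lindenbaum em ¬p
  in ⊥-elim (φ∉w (to value-𝒟 (Γ⊨φ (canonical em w) w λ γ γ∈Γ → from value-𝒟 (Γ⊆w γ∈Γ))))
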